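{- Let $v \ge 13$. Then every Steiner triple system $\mathrm{STS}(v)$ admits a $4$-good sequencing.
   Context: A Steiner triple system $\mathrm{STS}(v)$ is a pair $(V,\mathcal{B})$ where $V$ is a set of $v$ points and $\mathcal{B}$ is a collection of $3$-element subsets of $V$ (blocks) such that every pair of distinct points lies in exactly one block; such systems exist iff $v \equiv 1$ or $3 \pmod 6$. For an integer $\ell \ge 3$, an $\ell$-good sequencing is an ordering $x_1,\dots,x_v$ of all points of $V$ such that no $\ell$ consecutive points $x_i,\dots,x_{i+\ell-1}$ contain a block. -}

module Defs where

open import Data.Nat using (ℕ; _+_; _<_; _≤_)
open import Data.Fin using (Fin; toℕ)
open import Data.Product using (Σ; ∃; _×_; _,_)
open import Data.List using (List)
open import Data.List.Membership.Propositional using (_∈_)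
open import Relation.Binary.PropositionalEquality using (_≡_)
open import Relation.Nullary using (¬_)
open import Data.Fin.Permutation using (Permutation′; _⟨$⟩ʳ_)

-- A block is a 3-element subset of the point set Fin v, represented
-- canonically as a strictly increasing triple (a , b , c) with a < b < c.
record Block (v : ℕ) : Set where
  constructor blk
  field
    p₁ p₂ p₃ : Fin v
    p₁<p₂ : toℕ p₁ < toℕ p₂
    p₂<p₃ : toℕ p₂ < toℕ p₃

open Block public

_∈B_ : {v : ℕ} → Fin v → Block v → Set
x ∈B B = (x ≡ p₁ B) Data.Sum.⊎ ((x ≡ p₂ B) Data.Sum.⊎ (x ≡ p₃ B))
  where import Data.Sum

-- Two blocks are the same 3-subset iff their (canonical) point triples agree.
SameBlock : {v : ℕ} → Block v → Block v → Set
SameBlock B C = (p₁ B ≡ p₁ C) × (p₂ B ≡ p₂ C) × (p₃ B ≡ p₃ C)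

IsSTS : (v : ℕ) → List (Block v) → Set
IsSTS v ℬ =
  (x y : Fin v) → ¬ (x ≡ y) →
    Σ (Block v) (λ B → (B ∈ ℬ) × (x ∈B B) × (y ∈B B) ×
      ((C : Block v) → C ∈ ℬ → x ∈B C → y ∈B C → SameBlock B C))

-- An ℓ-good sequencing: an ordering x₀,…,x_{v-1} of all points (a
-- permutation of Fin v, position i ↦ point σ i) such that no ℓ consecutive
-- points x_i,…,x_{i+ℓ-1} contain a block.
IsGoodSequencing : (v ℓ : ℕ) → List (Block v) → Permutation′ v → Set
IsGoodSequencing v ℓ ℬ σ =
  (i : ℕ) → i + ℓ ≤ v → (B : Block v) → B ∈ ℬ →
    ¬ ((x : Fin v) → x ∈B B →
         Σ (Fin v) (λ j → (i ≤ toℕ j) × (toℕ j < i + ℓ) × (σ ⟨$⟩ʳ j ≡ x)))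

{-# OPTIONS --safe #-}
module Submission where

-- Write x ∙ y for the third point of the block through x and y. Fix an independent
-- 5-set W and points x, y, z outside it that form no block and satisfy x ∙ z, y ∙ z ∉ W.
-- Starting from z, y, x, extend the sequence to the right, greedily, by points outside W;
-- a point is refused only if it is one of the three products of the last three points
-- a, b, c. So at most three points are left when this stops, and all of them are such
-- products. One point w of W placed now lets all but one of them, p, follow. The other
-- points of W, and finally p, go to the left of z: independence makes blocks inside W
-- harmless, and w is chosen so that neither z nor p pairs up the remaining four points
-- of W completely, which leaves an order in which no block through z, y or p is too
-- short. Each condition on w excludes only one point of W, and there are at most four.

open import Defs
open import Data.Nat using (ℕ; zero; suc; _+_; _≤_; _<_; z≤n; s≤s)
open import Data.Nat.Properties using (≤-refl; ≤-trans; <-trans; <-irrefl; <-cmp; <⇒≱; suc-injective; +-monoˡ-<; +-monoˡ-≤; +-monoʳ-≤; +-assoc; +-comm; m≤n+m)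
open import Data.Fin using (Fin; zero; suc; toℕ; cast; _≟_)
open import Data.Fin.Properties using (toℕ-cast; toℕ-injective; cast-involutive; ¬∀⟶∃¬)
open import Data.Fin.Permutation using (Permutation′; permutation)
open import Data.List using (List; []; _∷_; _++_; length; map; lookup; allFin)
open import Data.List.Properties using (length-++; length-map; length-tabulate; ++-assoc; ++-identityʳ)
open import Data.List.Membership.Propositional using (_∈_; _∉_; find; lose)
open import Data.List.Membership.Propositional.Properties using (∈-∃++; ∈-++⁺ˡ; ∈-++⁺ʳ; ∈-++⁻; ∈-allFin; ∈-map⁺; ∈-lookup)
open import Data.List.Relation.Unary.All as All using (All; []; _∷_)
open import Data.List.Relation.Unary.All.Properties using (¬Any⇒All¬)
open import Data.List.Relation.Unary.Any using (here; there; any?; index)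
open import Data.List.Relation.Unary.Any.Properties using (lookup-index)
open import Data.List.Relation.Unary.AllPairs using ([]; _∷_)
open import Data.List.Relation.Unary.Unique.Propositional using (Unique)
open import Data.List.Relation.Unary.Unique.Propositional.Properties using (allFin⁺; Unique[x∷xs]⇒x∉xs)
open import Data.List.Relation.Binary.Permutation.Propositional using (_↭_; ↭-refl; ↭-sym; ↭-trans; ↭-reflexive; ↭⇒↭ₛ; prep; swap)
open import Data.List.Relation.Binary.Permutation.Propositional.Properties using (∈-resp-↭; ↭-length; ++⁺ˡ; ++⁺ʳ; shift; ++-comm)
open import Data.Product using (Σ; ∃; ∃₂; _×_; _,_; proj₁; proj₂)
open import Data.Sum using (_⊎_; inj₁; inj₂)
open import Data.Unit using (⊤; tt)
open import Function using (_∘_)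
open import Relation.Binary.Definitions using (tri<; tri≈; tri>)
open import Relation.Binary.PropositionalEquality using (_≡_; _≢_; refl; sym; trans; cong; cong₂; subst; setoid; ≢-sym)
open import Relation.Nullary using (Dec; yes; no; contradiction; ¬?)
open import Relation.Nullary.Decidable using (decidable-stable)
import Data.List.Membership.DecPropositional as DecMembership
import Data.List.Relation.Binary.Permutation.Setoid.Properties as SetoidPermutation

-- Lists without repetition

module _ {A : Set} where

  Unique-resp-↭ : {xs ys : List A} → xs ↭ ys → Unique xs → Unique ys
  Unique-resp-↭ p = SetoidPermutation.Unique-resp-↭ (setoid A) (↭⇒↭ₛ p)

  Unique-++⁻ʳ : ∀ xs {ys : List A} → Unique (xs ++ ys) → Unique ys
  Unique-++⁻ʳ []       u       = u
  Unique-++⁻ʳ (_ ∷ xs) (_ ∷ u) = Unique-++⁻ʳ xs u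

  Unique-++⁻ˡ : ∀ xs {ys : List A} → Unique (xs ++ ys) → Unique xs
  Unique-++⁻ˡ xs {ys} u = Unique-++⁻ʳ ys (Unique-resp-↭ (++-comm xs ys) u)

  remove : ∀ {x} {xs : List A} → x ∈ xs → ∃ λ ys → xs ↭ x ∷ ys
  remove x∈xs with ys , zs , refl ← ∈-∃++ x∈xs = ys ++ zs , shift _ ys zs

  ∈-tail : ∀ {x y} {ys : List A} → x ∈ y ∷ ys → x ≢ y → x ∈ ys
  ∈-tail (here x≡y)   x≢y = contradiction x≡y x≢y
  ∈-tail (there x∈ys) _   = x∈ys

  -- Pigeonhole principle: strike the head of `xs` from `ys`; uniqueness keeps the tail of `xs`
  -- inside what remains.
  unique-⊆⇒length≤ : ∀ {xs ys : List A} → Unique xs → (∀ {x} → x ∈ xs → x ∈ ys) →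
                     length xs ≤ length ys
  unique-⊆⇒length≤ []        _     = z≤n
  unique-⊆⇒length≤ {_ ∷ xs} (x∉ ∷ u) xs⊆ys with zs , ys↭ ← remove (xs⊆ys (here refl)) =
    subst (_ ≤_) (sym (↭-length ys↭)) (s≤s (unique-⊆⇒length≤ u λ y∈xs →
      ∈-tail (∈-resp-↭ ys↭ (xs⊆ys (there y∈xs))) (≢-sym (All.lookup x∉ y∈xs))))

  lookup-injective : ∀ {xs : List A} → Unique xs → ∀ i j → lookup xs i ≡ lookup xs j → i ≡ j
  lookup-injective {_ ∷ _}  _        zero    zero    _  = refl
  lookup-injective {_ ∷ xs} (x∉ ∷ _) zero    (suc j) eq = contradiction eq (All.lookup x∉ (∈-lookup j))
  lookup-injective {_ ∷ xs} (x∉ ∷ _) (suc i) zero    eq = contradiction (sym eq) (All.lookup x∉ (∈-lookup i))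
  lookup-injective {_ ∷ _}  (_ ∷ u)  (suc i) (suc j) eq = cong suc (lookup-injective u i j eq)

-- Points outside a given list

module _ {v : ℕ} where

  open DecMembership (_≟_ {v}) using (_∈?_)

  fresh : (xs : List (Fin v)) → length xs < v → ∃ λ x → x ∉ xs
  fresh xs <v = ¬∀⟶∃¬ v (_∈ xs) (_∈? xs) λ all →
    <⇒≱ <v (subst (_≤ length xs) (length-tabulate {n = v} (λ i → i))
      (unique-⊆⇒length≤ (allFin⁺ v) (λ {x} _ → all x)))

  completion : {xs : List (Fin v)} → Unique xs → ∃ λ ys → ys ++ xs ↭ allFin v
  completion {[]}     []       = allFin v , ↭-reflexive (++-identityʳ _)
  completion {x ∷ xs} (x∉ ∷ u) with completion u
  ... | ys , p with ∈-++⁻ ys (∈-resp-↭ (↭-sym p) (∈-allFin x))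
  ... | inj₂ x∈xs = contradiction refl (All.lookup x∉ x∈xs)
  ... | inj₁ x∈ys with zs , ys↭ ← remove x∈ys =
    zs , ↭-trans (shift x zs xs) (↭-trans (++⁺ʳ xs (↭-sym ys↭)) p)

-- Good sequences in a Steiner quasigroup

module Sequencing {v : ℕ} (_∙_ : Fin v → Fin v → Fin v)
  (idem : ∀ x → x ∙ x ≡ x)
  (comm : ∀ x y → x ∙ y ≡ y ∙ x)
  (cancel : ∀ x y → x ∙ (x ∙ y) ≡ y) where

  open DecMembership (_≟_ {v}) using (_∈?_)

  -- Together with `comm`, `swapˡ` and `rotate` make `x ∙ y ≡ z` symmetric in all three points, like
  -- membership in a common block.
  swapˡ : ∀ {x y z} → x ∙ y ≡ z → x ∙ z ≡ y
  swapˡ {x} {y} refl = cancel x y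

  rotate : ∀ {x y z} → x ∙ y ≡ z → y ∙ z ≡ x
  rotate {x} {y} eq = swapˡ (trans (comm y x) eq)

  ∙-injectiveˡ : ∀ {x y z} → x ∙ y ≡ x ∙ z → y ≡ z
  ∙-injectiveˡ {x} {y} {z} eq = trans (sym (swapˡ eq)) (cancel x z)

  fixed : ∀ {x y} → x ∙ y ≡ y → x ≡ y
  fixed {x} {y} eq = trans (sym (rotate eq)) (idem y)

  -- In Good xs no block lies inside four consecutive entries: the head is
  -- compared only with the three entries that follow it.
  Head : Fin v → List (Fin v) → Set
  Head a (b ∷ c ∷ d ∷ _) = a ∙ b ≢ c × a ∙ b ≢ d × a ∙ c ≢ d
  Head a (b ∷ c ∷ [])    = a ∙ b ≢ c
  Head a _               = ⊤

  Good : List (Fin v) → Set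
  Good []       = ⊤
  Good (x ∷ xs) = Head x xs × Good xs

  -- Since `x ∙ x ≡ x`, without `x ≢ y` only the empty list would qualify.
  Independent : List (Fin v) → Set
  Independent W = ∀ {x y z} → x ∈ W → y ∈ W → z ∈ W → x ≢ y → x ∙ y ≢ z

  products : List (Fin v) → List (Fin v)
  products []       = []
  products (x ∷ xs) = map (x ∙_) xs ++ products xs

  ∈-products : ∀ {x y} xs → x ∈ xs → y ∈ xs → x ≢ y → x ∙ y ∈ products xs
  ∈-products (_ ∷ xs) (here refl) (here refl) x≢y = contradiction refl x≢y
  ∈-products (_ ∷ xs) (here refl) (there y∈)  _   = ∈-++⁺ˡ (∈-map⁺ _ y∈)
  ∈-products {x} {y} (_ ∷ xs) (there x∈) (here refl) _ =
    ∈-++⁺ˡ (subst (_∈ map (y ∙_) xs) (comm y x) (∈-map⁺ _ x∈))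
  ∈-products (_ ∷ xs) (there x∈)  (there y∈)  x≢y = ∈-++⁺ʳ _ (∈-products xs x∈ y∈ x≢y)

  -- A block inside `w ∷ W` must contain `w` and two points of `W`; turned around, it exhibits `w`
  -- as a product of those two.
  independent-∷ : ∀ {w W} → Independent W → w ∉ W ++ products W → Independent (w ∷ W)
  independent-∷ {w} {W} ind w∉ = go
    where
    not-product : ∀ {x y} → x ∈ W → y ∈ W → x ∙ y ≢ w
    not-product {x} {y} x∈ y∈ eq with x ≟ y
    ... | yes refl = w∉ (∈-++⁺ˡ (subst (_∈ W) (trans (sym (idem x)) eq) x∈))
    ... | no  x≢y  = w∉ (∈-++⁺ʳ W (subst (_∈ products W) eq (∈-products W x∈ y∈ x≢y)))

    go : Independent (w ∷ W)
    go (here refl) (here refl) _           x≢y _  = x≢y refl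
    go (here refl) (there y∈)  (here refl) x≢y eq = x≢y (sym (trans (sym (swapˡ eq)) (idem _)))
    go (here refl) (there y∈)  (there z∈)  _   eq = not-product y∈ z∈ (rotate eq)
    go (there x∈)  (here refl) (here refl) x≢y eq = x≢y (fixed eq)
    go (there x∈)  (here refl) (there z∈)  _   eq = not-product x∈ z∈ (swapˡ eq)
    go (there x∈)  (there y∈)  (here refl) _   eq = not-product x∈ y∈ eq
    go (there x∈)  (there y∈)  (there z∈)  x≢y eq = ind x∈ y∈ z∈ x≢y eq

  -- Pairs cut out of a set by the blocks through a point

  -- The involution `m ∙_` fixes only `m`, so for `m ∉ W` it matches points of `W` in pairs, one
  -- pair per block through `m`; `u` is left single.
  Unmatched : Fin v → List (Fin v) → Set
  Unmatched m W = ∃ λ u → u ∈ W × m ∙ u ∉ W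

  -- The exceptional point e is the one left over when m pairs up all others.
  unmatched-without : ∀ m {W} → Unique W → m ∉ W →
    ∃ λ e → ∀ {w W′} → W ↭ w ∷ W′ → w ≢ e → Unmatched m W′
  unmatched-without m {W} uW m∉W with any? (λ u → ¬? (m ∙ u ∈? W)) W
  ... | yes some with u , u∈W , mu∉W ← find some =
    u , λ W↭ w≢u → u , ∈-tail (∈-resp-↭ W↭ u∈W) (≢-sym w≢u) ,
        (λ mu∈W′ → mu∉W (∈-resp-↭ (↭-sym W↭) (there mu∈W′)))
  -- All of `W` is matched, so deleting any `w` orphans `m ∙ w`. There is no exception to name; `m`,
  -- being outside `W`, fills the place.
  ... | no none = m , λ {w} {W′} W↭ _ →
    let w∈W = ∈-resp-↭ (↭-sym W↭) (here refl)
        mw≢w = λ eq → m∉W (subst (_∈ W) (sym (fixed eq)) w∈W)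
        mw∈W = matched w∈W
    in m ∙ w , ∈-tail (∈-resp-↭ W↭ mw∈W) mw≢w ,
       λ mmw∈W′ → Unique[x∷xs]⇒x∉xs (Unique-resp-↭ W↭ uW) (subst (_∈ W′) (cancel m w) mmw∈W′)
    where
    matched : ∀ {u} → u ∈ W → m ∙ u ∈ W
    matched {u} u∈W with m ∙ u ∈? W
    ... | yes mu∈W = mu∈W
    ... | no  mu∉W = contradiction (lose u∈W mu∉W) none

  -- Points of `W` other than `s` may then stand close to `m` in any order; only `s` has to be kept
  -- away.
  Separates : Fin v → List (Fin v) → Fin v → Set
  Separates m W s = ∀ {u u′} → u ∈ W → u′ ∈ W → u ≢ s → u′ ≢ s → m ∙ u ≢ u′

  -- An unmatched point leaves room for at most one m-pair in a 4-set.
  pair-separates : ∀ {m W s s′} → length W ≡ 4 → m ∉ W → Unmatched m W →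
    s ∈ W → s′ ∈ W → m ∙ s ≡ s′ → Separates m W s
  pair-separates {m} {W} {s} {s′} len m∉W (f , f∈ , mf∉) s∈ s′∈ ms≡s′ {u} {u′} u∈ u′∈ u≢s u′≢s mu≡u′ =
    <-irrefl refl (subst (5 ≤_) len (unique-⊆⇒length≤ distinct λ
      { (here refl) → f∈
      ; (there (here refl)) → s∈
      ; (there (there (here refl))) → s′∈
      ; (there (there (there (here refl)))) → u∈
      ; (there (there (there (there (here refl))))) → u′∈ }))
    where
    unlike : ∀ {x y} → m ∙ x ≡ y → y ∈ W → f ≢ x
    unlike eq y∈ refl = mf∉ (subst (_∈ W) (sym eq) y∈)
    moved : ∀ {x y} → x ∈ W → m ∙ x ≡ y → x ≢ y
    moved x∈ eq refl = m∉W (subst (_∈ W) (sym (fixed eq)) x∈)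
    distinct : Unique (f ∷ s ∷ s′ ∷ u ∷ u′ ∷ [])
    distinct =
      (unlike ms≡s′ s′∈ ∷ unlike (swapˡ ms≡s′) s∈ ∷ unlike mu≡u′ u′∈ ∷ unlike (swapˡ mu≡u′) u∈ ∷ []) ∷
      (moved s∈ ms≡s′ ∷ ≢-sym u≢s ∷ ≢-sym u′≢s ∷ []) ∷
      ((λ { refl → u′≢s (trans (sym mu≡u′) (swapˡ ms≡s′)) }) ∷
       (λ { refl → u≢s (∙-injectiveˡ (trans mu≡u′ (sym ms≡s′))) }) ∷ []) ∷
      (moved u∈ mu≡u′ ∷ []) ∷ [] ∷ []

  -- Either end of an `m`-pair separates; if there is no such pair, any two points do. Having two
  -- makes it possible to avoid a prescribed point.
  two-separators : ∀ {m W} → length W ≡ 4 → Unique W → m ∉ W → Unmatched m W →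
    ∃₂ λ s s′ → s ∈ W × s′ ∈ W × s ≢ s′ × Separates m W s × Separates m W s′
  two-separators {m} {W} len uW m∉W free with any? (λ u → m ∙ u ∈? W) W
  ... | yes some with s , s∈ , ms∈ ← find some =
    s , m ∙ s , s∈ , ms∈ , (λ eq → m∉W (subst (_∈ W) (sym (fixed (sym eq))) s∈)) ,
    pair-separates len m∉W free s∈ ms∈ refl ,
    pair-separates len m∉W free ms∈ s∈ (cancel m s)
  two-separators {m} {W@(s ∷ s′ ∷ _)} len ((s≢s′ ∷ _) ∷ _) m∉W free | no none =
    s , s′ , here refl , there (here refl) , s≢s′ , trivial , trivial
    where
    trivial : ∀ {t} → Separates m W t
    trivial u∈ u′∈ _ _ eq = none (lose u∈ (subst (_∈ W) (sym eq) u′∈))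

  separator-avoiding : ∀ {m W} → length W ≡ 4 → Unique W → m ∉ W → Unmatched m W →
    ∀ e → ∃ λ s → s ∈ W × s ≢ e × Separates m W s
  separator-avoiding len uW m∉W free e with two-separators len uW m∉W free
  ... | s , s′ , s∈ , s′∈ , s≢s′ , sep , sep′ with s ≟ e
  ... | no s≢e  = s , s∈ , s≢e , sep
  ... | yes refl = s′ , s′∈ , ≢-sym s≢s′ , sep′

  -- The greedy extension and the closing arrangement

  module Game (x y z : Fin v) (W : List (Fin v)) (|W|≡5 : length W ≡ 5)
    (independent : Independent W) (z∉W : z ∉ W)
    (xy≢z : x ∙ y ≢ z) (xz∉W : x ∙ z ∉ W) (yz∉W : y ∙ z ∉ W) where

    -- A partial sequencing, listed from its right end c, b, a, … down to its left
    -- end x, y, z; D and U are the unused points outside and inside W.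
    record State (D U : List (Fin v)) (c b a : Fin v) : Set where
      constructor state
      field
        rest   : List (Fin v)
        perm   : D ++ U ++ c ∷ b ∷ a ∷ rest ↭ allFin v
        -- Growth happens only at the right end, so goodness is kept relative to an undecided left
        -- part `L`, whose conditions involve only `x`, `y`, `z` and `L`.
        extend : ∀ L → Good (x ∷ y ∷ z ∷ L) → Good (c ∷ b ∷ a ∷ rest ++ L)

    open State

    Forbidden : Fin v → Fin v → Fin v → List (Fin v)
    Forbidden c b a = c ∙ b ∷ c ∙ a ∷ b ∙ a ∷ []

    unique : ∀ {D U c b a} (s : State D U c b a) → Unique (D ++ U ++ c ∷ b ∷ a ∷ rest s)
    unique s = Unique-resp-↭ (↭-sym (perm s)) (allFin⁺ v)

    size : ∀ {D U c b a} (s : State D U c b a) → length D + (length U + (3 + length (rest s))) ≡ v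
    size {D} {U} s = trans (cong (length D +_) (sym (length-++ U)))
      (trans (sym (length-++ D)) (trans (↭-length (perm s)) (length-tabulate {n = v} (λ i → i))))

    locate : ∀ {D U c b a} (s : State D U c b a) w →
      w ∈ D ⊎ w ∈ U ⊎ w ∈ c ∷ b ∷ a ∷ rest s
    locate {D} {U} s w with ∈-++⁻ D (∈-resp-↭ (↭-sym (perm s)) (∈-allFin w))
    ... | inj₁ w∈D = inj₁ w∈D
    ... | inj₂ w∈  = inj₂ (∈-++⁻ U w∈)

    push : ∀ {d D U c b a} → State (d ∷ D) U c b a → d ∉ Forbidden c b a → State D U d c b
    push {d} {D} {U} {c} {b} {a} (state r p e) d∉ = state (a ∷ r)
      (↭-trans (↭-reflexive (sym (++-assoc D U _)))
        (↭-trans (shift d (D ++ U) _) (↭-trans (prep d (↭-reflexive (++-assoc D U _))) p)))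
      λ L good → ((λ eq → d∉ (here (sym (rotate eq)))) ,
                  (λ eq → d∉ (there (here (sym (rotate eq))))) ,
                  (λ eq → d∉ (there (there (here (sym (rotate eq))))))) , e L good

    reorder : ∀ {D D′ U c b a} → D ↭ D′ → State D U c b a → State D′ U c b a
    reorder D↭ (state r p e) = state r (↭-trans (++⁺ʳ _ (↭-sym D↭)) p) e

    -- Hands a point of `W` to the outside points, so that `push` can place it or `finish` can use
    -- it as `p`.
    release : ∀ {D U w U′ c b a} → U ↭ w ∷ U′ → State D U c b a → State (w ∷ D) U′ c b a
    release {D} {w = w} {U′} U↭ (state r p e) = state r
      (↭-trans (↭-sym (shift w D _)) (↭-trans (++⁺ˡ D (++⁺ʳ _ (↭-sym U↭))) p)) e

    Goal : Set
    Goal = ∃ λ s → s ↭ allFin v × Good s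

    -- The list will end in `x y z u₁ u₂ u₃ u₄ p`. Here `z` reaches just `u₁`, `u₂`, `u₃` and `p`
    -- reaches just `u₂`, `u₃`, `u₄`, so `u₄` has to separate for `z` and `u₁` for `p`. As `x`
    -- reaches `u₁`, the latter must also differ from `x ∙ y`.
    finish : ∀ {p W′ c b a} → State (p ∷ []) W′ c b a → (∀ {w} → w ∈ W′ → w ∈ W) →
      length W′ ≡ 4 → Unmatched z W′ → Unmatched p W′ → Goal
    finish {p} {W′} {c} {b} {a} s W′⊆W |W′|≡4 zfree pfree
      with up@(_ ∷ uW′l) ← unique s
      with uW′ ← Unique-++⁻ˡ W′ uW′l
      with u₁ , u₁∈ , u₁≢xy , sepₚ ← separator-avoiding |W′|≡4 uW′
             (Unique[x∷xs]⇒x∉xs up ∘ ∈-++⁺ˡ) pfree (x ∙ y)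
      with u₄ , u₄∈ , u₄≢u₁ , sep ← separator-avoiding |W′|≡4 uW′ (z∉W ∘ W′⊆W) zfree u₁
      with X , W′↭₁ ← remove u₁∈
      with Y , X↭ ← remove (∈-tail (∈-resp-↭ W′↭₁ u₄∈) u₄≢u₁)
      with W′↭ ← ↭-trans W′↭₁ (prep u₁ X↭)
      with |Y|≡2 ← suc-injective (suc-injective (trans (sym (↭-length W′↭)) |W′|≡4))
      with uY ← Unique-resp-↭ W′↭ uW′
      = go Y |Y|≡2 W′↭ uY
      where
      arrange : ∀ {u₂ u₃} → W′ ↭ u₁ ∷ u₄ ∷ u₂ ∷ u₃ ∷ [] → Unique (u₁ ∷ u₄ ∷ u₂ ∷ u₃ ∷ []) →
                y ∙ u₁ ≢ u₂ → Goal
      arrange {u₂} {u₃} W′↭ ((≢₁₄ ∷ ≢₁₂ ∷ ≢₁₃ ∷ []) ∷ (≢₄₂ ∷ ≢₄₃ ∷ []) ∷ (≢₂₃ ∷ []) ∷ _) yu₁≢u₂ =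
        (c ∷ b ∷ a ∷ rest s) ++ u₁ ∷ u₂ ∷ u₃ ∷ u₄ ∷ p ∷ [] ,
        ↭-trans (++-comm (c ∷ b ∷ a ∷ rest s) _)
          (↭-trans (++⁺ʳ _ (↭-trans (shift p (u₁ ∷ u₂ ∷ u₃ ∷ u₄ ∷ []) [])
             (prep p (↭-trans (prep u₁ (shift u₄ (u₂ ∷ u₃ ∷ []) [])) (↭-sym W′↭))))) (perm s)) ,
        extend s _
          -- One row each for `x`, `y`, `z`, `u₁`, `u₂`, `u₃`, against the entries within reach
          -- after it.
          ( (xy≢z , ≢-sym u₁≢xy , ∉⇒≢ xz∉W ∈₁)
          , (∉⇒≢ yz∉W ∈₁ , ∉⇒≢ yz∉W ∈₂ , yu₁≢u₂)
          , (sep ∈₁′ ∈₂′ ≢₁₄ (≢-sym ≢₄₂) , sep ∈₁′ ∈₃′ ≢₁₄ (≢-sym ≢₄₃) , sep ∈₂′ ∈₃′ (≢-sym ≢₄₂) (≢-sym ≢₄₃))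
          , (independent ∈₁ ∈₂ ∈₃ ≢₁₂ , independent ∈₁ ∈₂ ∈₄ ≢₁₂ , independent ∈₁ ∈₃ ∈₄ ≢₁₃)
          , (independent ∈₂ ∈₃ ∈₄ ≢₂₃ , p-free ∈₂′ ∈₃′ ≢₁₂ ≢₁₃ , p-free ∈₂′ ∈₄′ ≢₁₂ ≢₁₄)
          , p-free ∈₃′ ∈₄′ ≢₁₃ ≢₁₄ , tt , tt , tt )
        where
        back : ∀ {w} → w ∈ u₁ ∷ u₄ ∷ u₂ ∷ u₃ ∷ [] → w ∈ W′
        back = ∈-resp-↭ (↭-sym W′↭)
        ∈₁′ = back (here refl)
        ∈₄′ = back (there (here refl))
        ∈₂′ = back (there (there (here refl)))
        ∈₃′ = back (there (there (there (here refl))))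
        ∈₁ = W′⊆W ∈₁′
        ∈₂ = W′⊆W ∈₂′
        ∈₃ = W′⊆W ∈₃′
        ∈₄ = W′⊆W ∈₄′
        ∉⇒≢ : ∀ {t w} → t ∉ W → w ∈ W → t ≢ w
        ∉⇒≢ t∉W w∈W refl = t∉W w∈W
        p-free : ∀ {u u′} → u ∈ W′ → u′ ∈ W′ → u₁ ≢ u → u₁ ≢ u′ → u ∙ u′ ≢ p
        p-free u∈ u′∈ ≢u ≢u′ eq = sepₚ u∈ u′∈ (≢-sym ≢u) (≢-sym ≢u′) (rotate (rotate eq))

      go : ∀ Y → length Y ≡ 2 → W′ ↭ u₁ ∷ u₄ ∷ Y → Unique (u₁ ∷ u₄ ∷ Y) → Goal
      -- The product `y ∙ u₁` equals at most one of `g` and `h`; the other one becomes `u₂`.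
      go (g ∷ h ∷ []) _ W′↭ uY with y ∙ u₁ ≟ g
      ... | no yu₁≢g = arrange W′↭ uY yu₁≢g
      ... | yes refl with (_ ∷ _ ∷ (g≢h ∷ []) ∷ _) ← uY =
        arrange (↭-trans W′↭ swapped) (Unique-resp-↭ swapped uY) g≢h
        where
        swapped : u₁ ∷ u₄ ∷ g ∷ h ∷ [] ↭ u₁ ∷ u₄ ∷ h ∷ g ∷ []
        swapped = prep u₁ (prep u₄ (swap g h ↭-refl))

    -- Positions in which no outside point can follow

    Stuck : ∀ {D c b a} → State D W c b a → Set
    Stuck {D} {c} {b} {a} _ = ∀ {d} → d ∈ D → d ∈ Forbidden c b a

    uniqueW : ∀ {D c b a} → State D W c b a → Unique W
    uniqueW {D} s = Unique-++⁻ˡ W (Unique-++⁻ʳ D (unique s))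

    |W′|≡4 : ∀ {w W′} → W ↭ w ∷ W′ → length W′ ≡ 4
    |W′|≡4 W↭ = suc-injective (trans (sym (↭-length W↭)) |W|≡5)

    W′⊆W : ∀ {w W′} → W ↭ w ∷ W′ → ∀ {u} → u ∈ W′ → u ∈ W
    W′⊆W W↭ u∈ = ∈-resp-↭ (↭-sym W↭) (there u∈)

    D∌W : ∀ {p D c b a} → State (p ∷ D) W c b a → p ∉ W
    D∌W {p} {D} s p∈W = Unique[x∷xs]⇒x∉xs (unique s) (∈-++⁺ʳ D (∈-++⁺ˡ p∈W))

    -- In the bound, 8 counts the points of W and the three last placed ones.
    fresh-in-state : ∀ {D c b a} (s : State D W c b a) (es : List (Fin v)) {k : ℕ} →
      length es ≡ k + length (rest s) → k < length D + 8 → ∃ λ w → w ∉ es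
    fresh-in-state {D} s es {k} |es| k< = fresh es (subst (length es <_) total
        (subst (_< length D + 8 + length (rest s)) (sym |es|) (+-monoˡ-< (length (rest s)) k<)))
      where
      total : length D + 8 + length (rest s) ≡ v
      total = trans (+-assoc (length D) 8 _)
        (trans (cong (λ n → length D + (n + (3 + length (rest s)))) (sym |W|≡5)) (size s))

    -- A point of W takes the part of p; independence leaves all others unmatched by it.
    stuck₀ : ∀ {c b a} → State [] W c b a → Goal
    stuck₀ {c} {b} {a} s
      with e , unmatched ← unmatched-without z (uniqueW s) z∉W
      with p , p∉ ← fresh-in-state s (e ∷ c ∷ b ∷ a ∷ rest s) {4} refl (s≤s (s≤s (s≤s (s≤s (s≤s z≤n)))))
      with locate s p
    ... | inj₂ (inj₂ p∈) = contradiction (there p∈) p∉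
    ... | inj₂ (inj₁ p∈W) with W′ , W↭ ← remove p∈W
                          with zfree@(u , u∈ , _) ← unmatched W↭ (p∉ ∘ here) =
      finish (release W↭ s) (W′⊆W W↭) (|W′|≡4 W↭) zfree
        (u , u∈ , λ pu∈ → independent p∈W (W′⊆W W↭ u∈) (W′⊆W W↭ pu∈)
          (λ { refl → Unique[x∷xs]⇒x∉xs (Unique-resp-↭ W↭ (uniqueW s)) u∈ }) refl)

    -- Besides `rest s`, eight entries are avoided: three products, the exceptions `e` and `f`, and
    -- `c`, `b`, `a`. This just fits below `1 + 8`. Being stuck puts `p` among the products, so the
    -- fresh point lies in `W`.
    stuck₁ : ∀ {p c b a} (s : State (p ∷ []) W c b a) → Stuck s → Goal
    stuck₁ {p} {c} {b} {a} s stuck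
      with e , unmatched ← unmatched-without z (uniqueW s) z∉W
      with f , unmatchedₚ ← unmatched-without p (uniqueW s) (D∌W s)
      with w , w∉ ← fresh-in-state s (Forbidden c b a ++ e ∷ f ∷ c ∷ b ∷ a ∷ rest s) {8} refl ≤-refl
      with locate s w
    ... | inj₁ w∈D = contradiction (∈-++⁺ˡ (stuck w∈D)) w∉
    ... | inj₂ (inj₂ w∈) = contradiction (∈-++⁺ʳ (Forbidden c b a) (there (there w∈))) w∉
    ... | inj₂ (inj₁ w∈W) with W′ , W↭ ← remove w∈W =
      finish (push (release W↭ s) (w∉ ∘ ∈-++⁺ˡ)) (W′⊆W W↭) (|W′|≡4 W↭)
        (unmatched W↭ (w∉ ∘ there ∘ there ∘ there ∘ here))
        (unmatchedₚ W↭ (w∉ ∘ there ∘ there ∘ there ∘ there ∘ here))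

    -- A point w of W is placed so that the blocked point q can follow it. Excluding
    -- b ∙ q and c ∙ q costs only one point of W, since one of the two is a.
    interpose : ∀ {q p D c b a} (s : State (q ∷ D) W c b a) → Stuck s → q ≢ c ∙ b → p ∈ D →
      (E : List (Fin v)) → length E < length D →
      ∃₂ λ w W′ → State D W′ q w c × (∀ {u} → u ∈ W′ → u ∈ W) × length W′ ≡ 4 ×
        Unmatched z W′ × Unmatched p W′ × w ∉ E × w ≢ b
    interpose {q} {p} {D} {c} {b} {a} s stuck q≢cb p∈D E |E|<|D|
      with e , unmatched ← unmatched-without z (uniqueW s) z∉W
      with f , unmatchedₚ ← unmatched-without p (uniqueW s)
             (λ p∈W → D∌W (reorder (↭-trans (prep q (proj₂ (remove p∈D))) (swap q p ↭-refl)) s) p∈W)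
      -- The list has `9 + length E` entries besides `rest s`, fewer than `suc (length D) + 8`. It
      -- need not name `a`, which is `b ∙ q` or `c ∙ q`, as `excluded` checks.
      with w , w∉ ← fresh-in-state s
             (Forbidden c b a ++ b ∙ q ∷ c ∙ q ∷ e ∷ f ∷ c ∷ b ∷ E ++ rest s) {9 + length E}
             (cong (9 +_) (length-++ E)) 
             (subst (10 + length E ≤_) (cong suc (+-comm 8 (length D))) (+-monoʳ-≤ 9 |E|<|D|))
      with locate s w
    ... | inj₁ w∈D = contradiction (∈-++⁺ˡ (stuck w∈D)) w∉
    ... | inj₂ (inj₂ w∈) = contradiction (excluded w∈ (stuck (here refl))) w∉
      where
      excluded : w ∈ c ∷ b ∷ a ∷ rest s → q ∈ Forbidden c b a →
                 w ∈ Forbidden c b a ++ b ∙ q ∷ c ∙ q ∷ e ∷ f ∷ c ∷ b ∷ E ++ rest s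
      excluded _ (here q≡cb) = contradiction q≡cb q≢cb
      excluded (here w≡c) _ = there (there (there (there (there (there (there (here w≡c)))))))
      excluded (there (here w≡b)) _ = there (there (there (there (there (there (there (there (here w≡b))))))))
      excluded (there (there (here refl))) (there (here refl)) = there (there (there (there (here (sym (cancel c a))))))
      excluded (there (there (here refl))) (there (there (here refl))) = there (there (there (here (sym (cancel b a)))))
      excluded (there (there (there w∈r))) _ = there (there (there (there (there (there (there (there (there (∈-++⁺ʳ E w∈r)))))))))
    ... | inj₂ (inj₁ w∈W) with W′ , W↭ ← remove w∈W =
      w , W′ , push (push (release W↭ s) (w∉ ∘ ∈-++⁺ˡ)) after-w , W′⊆W W↭ , |W′|≡4 W↭ ,
      unmatched W↭ (w∉ ∘ ∈-++⁺ʳ (Forbidden c b a) ∘ there ∘ there ∘ here) ,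
      unmatchedₚ W↭ (w∉ ∘ ∈-++⁺ʳ (Forbidden c b a) ∘ there ∘ there ∘ there ∘ here) ,
      (λ w∈E → w∉ (there (there (there (there (there (there (there (there (there (∈-++⁺ˡ w∈E))))))))))) ,
      (λ w≡b → w∉ (there (there (there (there (there (there (there (there (here w≡b))))))))))
      where
      after-w : q ∉ Forbidden w c b
      after-w (here q≡wc) = w∉ (there (there (there (there (here (sym (rotate (sym q≡wc))))))))
      after-w (there (here q≡wb)) = w∉ (there (there (there (here (sym (rotate (sym q≡wb)))))))
      after-w (there (there (here q≡cb))) = q≢cb q≡cb

    stuck₂ : ∀ {q p c b a} (s : State (q ∷ p ∷ []) W c b a) → Stuck s → q ≢ c ∙ b → Goal
    stuck₂ s stuck q≢cb
      with _ , _ , s′ , ⊆W , len , zfree , pfree , _ ← interpose s stuck q≢cb (here refl) [] (s≤s z≤n) =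
      finish s′ ⊆W len zfree pfree

    -- After `w` and `q`, the point `r` is to follow. Since `r ≡ c ∙ b`, the products `q ∙ c` and
    -- `w ∙ c` could block it only if `q` or `w` were `b`; so the single extra point for `w` to
    -- avoid is `q ∙ r`.
    stuck₃ : ∀ {q r p c b a} (s : State (q ∷ r ∷ p ∷ []) W c b a) → Stuck s → r ≡ c ∙ b → Goal
    stuck₃ {q} {r} {p} {c} {b} {a} s stuck r≡cb
      with (q≢r ∷ q≢) ∷ _ ← unique s
      with w , _ , s′ , ⊆W , len , zfree , pfree , w∉ , w≢b ←
             interpose s stuck (λ q≡cb → q≢r (trans q≡cb (sym r≡cb))) (there (here refl))
               (q ∙ r ∷ []) (s≤s (s≤s z≤n)) =
      finish (push s′ after-q) ⊆W len zfree pfree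
      where
      c∙⇒b : ∀ {u} → r ≡ u ∙ c → u ≡ b
      c∙⇒b {u} eq = ∙-injectiveˡ {c} (trans (comm c u) (trans (sym eq) r≡cb))
      q≢b : q ≢ b
      q≢b = All.lookup q≢ (there (∈-++⁺ʳ W (there (here refl))))
      after-q : r ∉ Forbidden q w c
      after-q (here r≡qw) = w∉ (here (sym (swapˡ (sym r≡qw))))
      after-q (there (here r≡qc)) = q≢b (c∙⇒b r≡qc)
      after-q (there (there (here r≡wc))) = w≢b (c∙⇒b r≡wc)

    stuck-wins : ∀ {D c b a} (s : State D W c b a) → Stuck s → Goal
    stuck-wins {[]} s _ = stuck₀ s
    stuck-wins {_ ∷ []} s stuck = stuck₁ s stuck
    stuck-wins {q ∷ p ∷ []} {c} {b} s stuck with q ≟ c ∙ b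
    ... | no q≢cb = stuck₂ s stuck q≢cb
    ... | yes q≡cb with (q≢p ∷ _) ∷ _ ← unique s =
      stuck₂ (reorder (swap q p ↭-refl) s) (stuck ∘ ∈-resp-↭ (swap p q ↭-refl))
        (λ p≡cb → q≢p (trans q≡cb (sym p≡cb)))
    stuck-wins {D@(_ ∷ _ ∷ _ ∷ [])} {c} {b} {a} s stuck with c ∙ b ∈? D
    ... | no cb∉D = contradiction
      (unique-⊆⇒length≤ {ys = c ∙ a ∷ b ∙ a ∷ []} (Unique-++⁻ˡ D (unique s))
        (λ d∈D → ∈-tail (stuck d∈D) (λ { refl → cb∉D d∈D })))
      (λ { (s≤s (s≤s ())) })
    ... | yes cb∈D with remove cb∈D
    ...   | q ∷ p ∷ [] , D↭ with D↭′ ← ↭-trans D↭ (swap (c ∙ b) q ↭-refl) =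
      stuck₃ (reorder D↭′ s) (stuck ∘ ∈-resp-↭ (↭-sym D↭′)) refl
    ...   | [] , D↭ = contradiction (↭-length D↭) λ ()
    ...   | _ ∷ [] , D↭ = contradiction (↭-length D↭) λ ()
    ...   | _ ∷ _ ∷ _ ∷ _ , D↭ = contradiction (↭-length D↭) λ ()
    stuck-wins {D@(_ ∷ _ ∷ _ ∷ _ ∷ _)} s stuck = contradiction
      (unique-⊆⇒length≤ (Unique-++⁻ˡ D (unique s)) stuck)
      (λ { (s≤s (s≤s (s≤s ()))) })

    play : ∀ n {D c b a} → length D ≡ n → State D W c b a → Goal
    play n {D} {c} {b} {a} |D|≡n s with any? (λ d → ¬? (d ∈? Forbidden c b a)) D
    ... | no none = stuck-wins s λ {d} d∈D → decidable-stable (d ∈? Forbidden c b a) (none ∘ lose d∈D)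
    ... | yes some with d , d∈D , d∉ ← find some with D′ , D↭ ← remove d∈D with n
    ...   | zero  = contradiction (trans (sym (↭-length D↭)) |D|≡n) λ ()
    ...   | suc m = play m (suc-injective (trans (sym (↭-length D↭)) |D|≡n)) (push (reorder D↭ s) d∉)

    win : Unique (x ∷ y ∷ z ∷ W) → Goal
    win u with D , p ← completion u =
      play (length D) {D} refl
        (state [] (↭-trans (++⁺ˡ D (++-comm W (x ∷ y ∷ z ∷ []))) p) (λ _ good → good))

  -- Choosing the independent set and the starting points

  -- The binomial coefficient `n` over 2, counting pairs; in particular `triangle 5` is 10.
  triangle : ℕ → ℕ
  triangle zero    = 0
  triangle (suc n) = n + triangle n

  length-products : ∀ W → length (products W) ≡ triangle (length W)
  length-products []       = refl
  length-products (w ∷ W) = trans (length-++ (map (w ∙_) W))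
    (cong₂ _+_ (length-map (w ∙_) W) (length-products W))

  -- Greedy choice: the next point avoids the `n` chosen ones and their `triangle n` products,
  -- `triangle (suc n)` entries in all.
  independent-set : ∀ n → triangle n < v → ∃ λ W → length W ≡ n × Unique W × Independent W
  independent-set zero    _  = [] , refl , [] , λ ()
  independent-set (suc n) <v
    with W , refl , uW , ind ← independent-set n (≤-trans (s≤s (m≤n+m _ n)) <v)
    with w , w∉ ← fresh (W ++ products W)
           (subst (_< v) (sym (trans (length-++ W) (cong (length W +_) (length-products W)))) <v) =
    w ∷ W , refl , ¬Any⇒All¬ W (w∉ ∘ ∈-++⁺ˡ) ∷ uW , independent-∷ ind w∉

  Start : List (Fin v) → Set
  Start W = ∃₂ λ x y → ∃ λ z → Unique (x ∷ y ∷ z ∷ W) × x ∙ y ≢ z × x ∙ z ∉ W × y ∙ z ∉ W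

  -- With z = w₁ ∙ w₂ only three points outside W form a block with z and a point of W.
  start : ∀ {w₁ w₂ w₃ w₄ w₅} → let W = w₁ ∷ w₂ ∷ w₃ ∷ w₄ ∷ w₅ ∷ [] in
    13 ≤ v → Unique W → Independent W → Start W
  start {w₁} {w₂} {w₃} {w₄} {w₅} 13≤v uW@((w₁≢w₂ ∷ _) ∷ _) ind =
    choose (w₁ ∙ w₂) refl (λ z∈W → ind (here refl) (there (here refl)) z∈W w₁≢w₂ refl)
    where
    W = w₁ ∷ w₂ ∷ w₃ ∷ w₄ ∷ w₅ ∷ []

    choose : ∀ z → w₁ ∙ w₂ ≡ z → z ∉ W → Start W
    choose z w₁w₂≡z z∉W
      with x , x∉ ← fresh (z ∷ z ∙ w₃ ∷ z ∙ w₄ ∷ z ∙ w₅ ∷ W) (≤-trans (m≤n+m 10 3) 13≤v)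
      -- Avoiding `x ∙ z` keeps `x`, `y`, `z` from forming a block. Eleven entries are excluded,
      -- nine for `x` above.
      with y , y∉ ← fresh (x ∷ x ∙ z ∷ z ∷ z ∙ w₃ ∷ z ∙ w₄ ∷ z ∙ w₅ ∷ W) (≤-trans (m≤n+m 12 1) 13≤v)
      = x , y , z ,
        ((≢-sym (y∉ ∘ here) ∷ (x∉ ∘ here) ∷ outside x∉) ∷
         ((y∉ ∘ there ∘ there ∘ here) ∷ outside (y∉ ∘ there ∘ there)) ∷ ¬Any⇒All¬ W z∉W ∷ uW) ,
        (λ eq → y∉ (there (here (sym (swapˡ eq))))) ,
        third∉W x∉ , third∉W (y∉ ∘ there ∘ there)
      where
      outside : ∀ {u} → u ∉ z ∷ z ∙ w₃ ∷ z ∙ w₄ ∷ z ∙ w₅ ∷ W → All (u ≢_) W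
      outside u∉ = ¬Any⇒All¬ W (u∉ ∘ there ∘ there ∘ there ∘ there)

      third∉W : ∀ {u} → u ∉ z ∷ z ∙ w₃ ∷ z ∙ w₄ ∷ z ∙ w₅ ∷ W → u ∙ z ∉ W
      third∉W u∉ (here eq) = u∉ (there (there (there (there (there (here
        (trans (sym (rotate eq)) (rotate (rotate w₁w₂≡z)))))))))
      third∉W u∉ (there (here eq)) = u∉ (there (there (there (there (here
        (trans (sym (rotate eq)) (trans (comm z w₂) (rotate w₁w₂≡z))))))))
      third∉W u∉ (there (there (here eq))) = u∉ (there (here (sym (rotate eq))))
      third∉W u∉ (there (there (there (here eq)))) = u∉ (there (there (here (sym (rotate eq)))))
      third∉W u∉ (there (there (there (there (here eq))))) = u∉ (there (there (there (here (sym (rotate eq))))))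

  good-sequence : 13 ≤ v → ∃ λ s → s ↭ allFin v × Good s
  good-sequence 13≤v = from (independent-set 5 (≤-trans (m≤n+m 11 2) 13≤v))
    where
    play-from : ∀ {W} → length W ≡ 5 → Independent W → Start W → ∃ λ s → s ↭ allFin v × Good s
    play-from |W|≡5 ind (x , y , z , u , xy≢z , xz∉W , yz∉W) =
      Game.win x y z _ |W|≡5 ind (Unique[x∷xs]⇒x∉xs (Unique-++⁻ʳ (x ∷ y ∷ []) u)) xy≢z xz∉W yz∉W u

    from : (∃ λ W → length W ≡ 5 × Unique W × Independent W) → ∃ λ s → s ↭ allFin v × Good s
    from (_ ∷ _ ∷ _ ∷ _ ∷ _ ∷ [] , refl , uW , ind) = play-from refl ind (start 13≤v uW ind)

  -- From `Good` to arbitrary triples in a window of four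

  head-pair : ∀ {x} xs → Head x xs → ∀ (j k : Fin (length xs)) → toℕ j < toℕ k → toℕ k < 3 →
    x ∙ lookup xs j ≢ lookup xs k
  head-pair (_ ∷ [])            _           _             (suc ())            _                  _
  head-pair (_ ∷ _ ∷ [])        xy≢z        zero          (suc zero)          _                  _ = xy≢z
  head-pair (_ ∷ _ ∷ [])        _           (suc _)       (suc zero)          (s≤s ())           _
  head-pair (_ ∷ _ ∷ _ ∷ _)     (≢ , _ , _) zero          (suc zero)          _                  _ = ≢
  head-pair (_ ∷ _ ∷ _ ∷ _)     (_ , ≢ , _) zero          (suc (suc zero))    _                  _ = ≢
  head-pair (_ ∷ _ ∷ _ ∷ _)     (_ , _ , ≢) (suc zero)    (suc (suc zero))    _                  _ = ≢
  head-pair (_ ∷ _ ∷ _ ∷ _)     _           (suc _)       (suc zero)          (s≤s ())           _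
  head-pair (_ ∷ _ ∷ _ ∷ _)     _           (suc (suc _)) (suc (suc zero))    (s≤s (s≤s ()))     _
  head-pair (_ ∷ _ ∷ _ ∷ _)     _           _             (suc (suc (suc _))) _ (s≤s (s≤s (s≤s ())))

  good-triple : ∀ {s} → Good s → ∀ (i j k : Fin (length s)) → toℕ i < toℕ j → toℕ j < toℕ k →
    toℕ k < toℕ i + 4 → lookup s i ∙ lookup s j ≢ lookup s k
  good-triple {_ ∷ s} (h , _) zero    (suc j) (suc k) _         (s≤s j<k) (s≤s k<) = head-pair s h j k j<k k<
  good-triple {_ ∷ s} (_ , g) (suc i) (suc j) (suc k) (s≤s i<j) (s≤s j<k) (s≤s k<) =
    good-triple g i j k i<j j<k k<

  -- `Good` speaks of triples in list order only, so the three positions are sorted and the equation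
  -- is turned accordingly by the symmetries of `∙`.
  good-window : ∀ {s} → Good s → ∀ n {i j k : Fin (length s)} →
    n ≤ toℕ i → n ≤ toℕ j → n ≤ toℕ k → toℕ i < n + 4 → toℕ j < n + 4 → toℕ k < n + 4 →
    i ≢ j → j ≢ k → k ≢ i → lookup s i ∙ lookup s j ≢ lookup s k
  good-window g n {i} {j} {k} n≤i n≤j n≤k i< j< k< i≢j j≢k k≢i eq
    with <-cmp (toℕ i) (toℕ j) | <-cmp (toℕ j) (toℕ k) | <-cmp (toℕ k) (toℕ i)
  ... | tri≈ _ i≡j _ | _ | _ = i≢j (toℕ-injective i≡j)
  ... | _ | tri≈ _ j≡k _ | _ = j≢k (toℕ-injective j≡k)
  ... | _ | _ | tri≈ _ k≡i _ = k≢i (toℕ-injective k≡i)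
  ... | tri< i<j _ _ | tri< j<k _ _ | _ =
    good-triple g i j k i<j j<k (≤-trans k< (+-monoˡ-≤ 4 n≤i)) eq
  ... | tri< i<j _ _ | tri> _ _ k<j | tri> _ _ i<k =
    good-triple g i k j i<k k<j (≤-trans j< (+-monoˡ-≤ 4 n≤i)) (swapˡ eq)
  ... | tri< i<j _ _ | tri> _ _ k<j | tri< k<i _ _ =
    good-triple g k i j k<i i<j (≤-trans j< (+-monoˡ-≤ 4 n≤k)) (rotate (rotate eq))
  ... | tri> _ _ j<i | tri< j<k _ _ | tri> _ _ i<k =
    good-triple g j i k j<i i<k (≤-trans k< (+-monoˡ-≤ 4 n≤j)) (trans (comm _ _) eq)
  ... | tri> _ _ j<i | tri< j<k _ _ | tri< k<i _ _ =
    good-triple g j k i j<k k<i (≤-trans i< (+-monoˡ-≤ 4 n≤j)) (rotate eq)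
  ... | tri> _ _ j<i | tri> _ _ k<j | _ =
    good-triple g k j i k<j j<i (≤-trans i< (+-monoˡ-≤ 4 n≤k)) (trans (comm _ _) (rotate eq))

-- Third points of blocks

module _ {v : ℕ} where

  p₁≢p₂ : (B : Block v) → p₁ B ≢ p₂ B
  p₁≢p₂ B eq = <-irrefl (cong toℕ eq) (p₁<p₂ B)

  p₂≢p₃ : (B : Block v) → p₂ B ≢ p₃ B
  p₂≢p₃ B eq = <-irrefl (cong toℕ eq) (p₂<p₃ B)

  p₃≢p₁ : (B : Block v) → p₃ B ≢ p₁ B
  p₃≢p₁ B eq = <-irrefl (cong toℕ (sym eq)) (<-trans (p₁<p₂ B) (p₂<p₃ B))

  ∈B⇒∈ : ∀ {x} {B : Block v} → x ∈B B → x ∈ p₁ B ∷ p₂ B ∷ p₃ B ∷ []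
  ∈B⇒∈ (inj₁ eq)        = here eq
  ∈B⇒∈ (inj₂ (inj₁ eq)) = there (here eq)
  ∈B⇒∈ (inj₂ (inj₂ eq)) = there (there (here eq))

  SameBlock-∈B : ∀ {x} {B C : Block v} → SameBlock B C → x ∈B B → x ∈B C
  SameBlock-∈B (eq , _ , _) (inj₁ refl)        = inj₁ eq
  SameBlock-∈B (_ , eq , _) (inj₂ (inj₁ refl)) = inj₂ (inj₁ eq)
  SameBlock-∈B (_ , _ , eq) (inj₂ (inj₂ refl)) = inj₂ (inj₂ eq)

  third-point : (B : Block v) → ∀ x y → ∃ λ z → z ∈B B × z ≢ x × z ≢ y
  third-point B x y with p₁ B ≟ x | p₁ B ≟ y | p₂ B ≟ x | p₂ B ≟ y
  ... | no ≢x | no ≢y | _ | _ = p₁ B , inj₁ refl , ≢x , ≢y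
  ... | _ | _ | no ≢x | no ≢y = p₂ B , inj₂ (inj₁ refl) , ≢x , ≢y
  ... | yes p₁≡x | _ | yes p₂≡x | _ = contradiction (trans p₁≡x (sym p₂≡x)) (p₁≢p₂ B)
  ... | _ | yes p₁≡y | _ | yes p₂≡y = contradiction (trans p₁≡y (sym p₂≡y)) (p₁≢p₂ B)
  -- In the remaining cases `p₁ B` and `p₂ B` are `x` and `y` in some order, which leaves `p₃ B`.
  ... | yes refl | _ | _ | yes refl = p₃ B , inj₂ (inj₂ refl) , p₃≢p₁ B , ≢-sym (p₂≢p₃ B)
  ... | _ | yes refl | yes refl | _ = p₃ B , inj₂ (inj₂ refl) , ≢-sym (p₂≢p₃ B) , p₃≢p₁ B

  third-point-unique : ∀ {x y z z′} {B : Block v} → x ∈B B → y ∈B B → z ∈B B → z′ ∈B B →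
    x ≢ y → z ≢ x → z ≢ y → z′ ≢ x → z′ ≢ y → z ≡ z′
  third-point-unique {x} {y} {z} {z′} {B} x∈ y∈ z∈ z′∈ x≢y z≢x z≢y z′≢x z′≢y with z ≟ z′
  ... | yes z≡z′ = z≡z′
  ... | no  z≢z′ = contradiction
    (unique-⊆⇒length≤ {xs = x ∷ y ∷ z ∷ z′ ∷ []} {ys = p₁ B ∷ p₂ B ∷ p₃ B ∷ []}
      ((x≢y ∷ ≢-sym z≢x ∷ ≢-sym z′≢x ∷ []) ∷ (≢-sym z≢y ∷ ≢-sym z′≢y ∷ []) ∷ (z≢z′ ∷ []) ∷ [] ∷ [])
      λ { (here refl) → ∈B⇒∈ {B = B} x∈
        ; (there (here refl)) → ∈B⇒∈ {B = B} y∈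
        ; (there (there (here refl))) → ∈B⇒∈ {B = B} z∈
        ; (there (there (there (here refl)))) → ∈B⇒∈ {B = B} z′∈ })
    λ { (s≤s (s≤s (s≤s ()))) }

-- Permutations from sequences

module _ {v : ℕ} {s : List (Fin v)} (s↭ : s ↭ allFin v) where

  |s|≡v : length s ≡ v
  |s|≡v = trans (↭-length s↭) (length-tabulate {n = v} (λ i → i))

  position : Fin v → Fin (length s)
  position = cast (sym |s|≡v)

  -- The inverse looks up where a point occurs in `s`. One inverse law is the correctness of that
  -- search, the other follows because `s` has no repetitions.
  sequence⇒permutation : Permutation′ v
  sequence⇒permutation = permutation at where-is at-where-is
    (λ i → at-injective (at-where-is (at i)))
    where
    at : Fin v → Fin v
    at i = lookup s (position i)
    member : ∀ x → x ∈ s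
    member x = ∈-resp-↭ (↭-sym s↭) (∈-allFin x)
    where-is : Fin v → Fin v
    where-is x = cast |s|≡v (index (member x))
    at-where-is : ∀ x → at (where-is x) ≡ x
    at-where-is x = trans (cong (lookup s) (cast-involutive (sym |s|≡v) |s|≡v (index (member x))))
                          (sym (lookup-index (member x)))
    at-injective : ∀ {i j} → at i ≡ at j → i ≡ j
    at-injective {i} {j} eq = toℕ-injective (trans (sym (toℕ-cast (sym |s|≡v) i))
      (trans (cong toℕ (lookup-injective (Unique-resp-↭ (↭-sym s↭) (allFin⁺ v)) _ _ eq))
             (toℕ-cast (sym |s|≡v) j)))

-- The Steiner quasigroup of a triple system

module SteinerQuasigroup {v : ℕ} {ℬ : List (Block v)} (sts : IsSTS v ℬ) where

  infixl 7 _∙_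

  _∙_ : Fin v → Fin v → Fin v
  x ∙ y with x ≟ y
  ... | yes _  = x
  ... | no x≢y = proj₁ (third-point (proj₁ (sts x y x≢y)) x y)

  idem : ∀ x → x ∙ x ≡ x
  idem x with x ≟ x
  ... | yes _  = refl
  ... | no x≢x = contradiction refl x≢x

  ∙-in-block : ∀ {x y} → x ≢ y →
    ∃ λ B → B ∈ ℬ × x ∈B B × y ∈B B × (x ∙ y) ∈B B × x ∙ y ≢ x × x ∙ y ≢ y
  ∙-in-block {x} {y} x≢y with x ≟ y
  ... | yes x≡y = contradiction x≡y x≢y
  ... | no  x≢y with B , B∈ , x∈ , y∈ , _ ← sts x y x≢y = B , B∈ , x∈ , y∈ , proj₂ (third-point B x y)

  -- `B` and the block defining `x ∙ y` both agree with the one block through `x` and `y`, and a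
  -- block has room for just one third point.
  ∙-unique : ∀ {x y z B} → B ∈ ℬ → x ∈B B → y ∈B B → z ∈B B → x ≢ y → z ≢ x → z ≢ y → x ∙ y ≡ z
  ∙-unique {x} {y} {z} {B} B∈ x∈ y∈ z∈ x≢y z≢x z≢y
    with C , C∈ , x∈C , y∈C , xy∈C , xy≢x , xy≢y ← ∙-in-block x≢y
    with A , _ , _ , _ , only ← sts x y x≢y
    with A≈B ← only B B∈ x∈ y∈ | A≈C ← only C C∈ x∈C y∈C =
    third-point-unique {B = C} x∈C y∈C xy∈C z∈C x≢y xy≢x xy≢y z≢x z≢y
    where
    z∈C : z ∈B C
    z∈C = SameBlock-∈B {B = A} {C} A≈C (SameBlock-∈B {B = B} {A} (sym-block A≈B) z∈)
      where
      sym-block : SameBlock A B → SameBlock B A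
      sym-block (e₁ , e₂ , e₃) = sym e₁ , sym e₂ , sym e₃

  comm : ∀ x y → x ∙ y ≡ y ∙ x
  comm x y = by-cases (x ≟ y)
    where
    by-cases : Dec (x ≡ y) → x ∙ y ≡ y ∙ x
    by-cases (yes refl) = refl
    by-cases (no x≢y) with B , B∈ , y∈ , x∈ , yx∈ , yx≢y , yx≢x ← ∙-in-block (≢-sym x≢y) =
      ∙-unique B∈ x∈ y∈ yx∈ x≢y yx≢x yx≢y

  cancel : ∀ x y → x ∙ (x ∙ y) ≡ y
  cancel x y = by-cases (x ≟ y)
    where
    by-cases : Dec (x ≡ y) → x ∙ (x ∙ y) ≡ y
    by-cases (yes refl) = trans (cong (x ∙_) (idem x)) (idem x)
    by-cases (no x≢y) with B , B∈ , x∈ , y∈ , xy∈ , xy≢x , xy≢y ← ∙-in-block x≢y =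
      ∙-unique B∈ x∈ xy∈ y∈ (≢-sym xy≢x) (≢-sym x≢y) (≢-sym xy≢y)

  open Sequencing _∙_ idem comm cancel using (Good; good-window; good-sequence) public

  -- A block inside the window would give three distinct positions in it whose entries satisfy
  -- `x ∙ y ≡ z`, against `good-window`.
  good⇒sequencing : ∀ {s} (s↭ : s ↭ allFin v) → Good s →
    IsGoodSequencing v 4 ℬ (sequence⇒permutation s↭)
  good⇒sequencing {s} s↭ good n _ B B∈ inside =
    let j₁ , n≤j₁ , j₁< , at₁ = inside (p₁ B) (inj₁ refl)
        j₂ , n≤j₂ , j₂< , at₂ = inside (p₂ B) (inj₂ (inj₁ refl))
        j₃ , n≤j₃ , j₃< , at₃ = inside (p₃ B) (inj₂ (inj₂ refl))
    in good-window good n (later j₁ n≤j₁) (later j₂ n≤j₂) (later j₃ n≤j₃)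
         (earlier j₁ j₁<) (earlier j₂ j₂<) (earlier j₃ j₃<)
         (λ eq → p₁≢p₂ B (trans (sym at₁) (trans (cong (lookup s) eq) at₂)))
         (λ eq → p₂≢p₃ B (trans (sym at₂) (trans (cong (lookup s) eq) at₃)))
         (λ eq → p₃≢p₁ B (trans (sym at₃) (trans (cong (lookup s) eq) at₁)))
         (trans (cong₂ _∙_ at₁ at₂) (trans
           (∙-unique B∈ (inj₁ refl) (inj₂ (inj₁ refl)) (inj₂ (inj₂ refl))
             (p₁≢p₂ B) (p₃≢p₁ B) (≢-sym (p₂≢p₃ B)))
           (sym at₃)))
    where
    later : ∀ j → n ≤ toℕ j → n ≤ toℕ (position s↭ j)
    later j = subst (n ≤_) (sym (toℕ-cast (sym (|s|≡v s↭)) j))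
    earlier : ∀ j → toℕ j < n + 4 → toℕ (position s↭ j) < n + 4
    earlier j = subst (_< n + 4) (sym (toℕ-cast (sym (|s|≡v s↭)) j))

theorem3p1 : (v : ℕ) → 13 ≤ v → (ℬ : List (Block v)) → IsSTS v ℬ →
    Σ (Permutation′ v) (λ σ → IsGoodSequencing v 4 ℬ σ)
theorem3p1 v 13≤v ℬ sts = from (good-sequence 13≤v)
  where
  open SteinerQuasigroup sts
  from : (∃ λ s → s ↭ allFin v × Good s) → Σ (Permutation′ v) (λ σ → IsGoodSequencing v 4 ℬ σ)
  from (_ , s↭ , good) = sequence⇒permutation s↭ , good⇒sequencing s↭ good
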